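{- For every integer $M\ge 4$, the halved cube $\Delta_M$ is a deletion host for $T_M$; that is, $E(\Delta_M)\neq\varnothing$, $\Delta_M$ contains no induced subgraph isomorphic to $T_M$, and for every edge $e$ of $\Delta_M$ the graph $\Delta_M-e$ contains an induced subgraph isomorphic to $T_M$.
   Context: The halved cube $\Delta_n$ is the graph whose vertices are the even-cardinality subsets of $[n]=\{1,\dots,n\}$, with $X,Y$ adjacent if and only if $|X\mathbin{\triangle}Y|=2$ (symmetric difference). $T_M$ is the graph formed from a clique of order $M$ by adding one vertex with exactly two neighbors in the clique. $\Delta_M-e$ denotes deletion of the edge $e$, keeping all vertices. -}

module Defs where

open import Data.Empty using (⊥)
open import Data.Fin.Base using (Fin; toℕ)
open import Data.Fin.Subset as Subset using (Subset; inside; outside; _∪_; _─_; ∣_∣)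
open import Data.Fin.Subset.Properties using (∪-comm; ∣⊥∣≡0)
open import Data.Maybe.Base using (Maybe; just; nothing)
open import Data.Nat.Base using (ℕ; _<_)
open import Data.Nat.Divisibility using (_∣_)
open import Data.Product.Base using (Σ; _×_; _,_; ∃-syntax)
open import Data.Refinement.Base using (value; Refinement-syntax)
open import Data.Sum.Base using (_⊎_; [_,_]; inj₁; inj₂)
open import Data.Vec.Base using ([]; _∷_)
open import Function.Bundles using (_↔_; _⇔_; Inverse)
open import Level using (0ℓ)
open import Relation.Binary.Core using (Rel)
open import Relation.Binary.Definitions using (Symmetric)
open import Relation.Binary.PropositionalEquality
  using (_≡_; _≢_; refl; sym; trans; cong; ≢-sym)
open import Relation.Nullary.Negation using (¬_)
open import Relation.Unary using (Pred)

record SimpleGraph : Set₁ where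
  field
    Vertex    : Set
    Adj       : Rel Vertex 0ℓ
    symmetric : Symmetric Adj
    loopless  : ∀ x → ¬ Adj x x

open SimpleGraph public

record _≅_ (G H : SimpleGraph) : Set where
  field
    vertices : Vertex G ↔ Vertex H
    adjacent : ∀ x y → Adj G x y ⇔ Adj H (Inverse.to vertices x) (Inverse.to vertices y)

-- Membership proofs in a refinement type are irrelevant, so the vertices of
-- G [ S ] are exactly the vertices of G lying in S, without duplicates.
_[_] : (G : SimpleGraph) → Pred (Vertex G) 0ℓ → SimpleGraph
Vertex    (G [ S ])     = [ x ∈ Vertex G ∣ S x ]
Adj       (G [ S ]) x y = Adj G (value x) (value y)
symmetric (G [ S ])     = symmetric G
loopless  (G [ S ]) x   = loopless G (value x)

ContainsInduced : SimpleGraph → SimpleGraph → Set₁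
ContainsInduced G H = ∃[ S ] (G [ S ]) ≅ H

-- Each edge is given together with an ordering of its two ends; deleting an
-- edge does not depend on that ordering.
Edge : SimpleGraph → Set
Edge G = Σ (Vertex G) λ x → Σ (Vertex G) λ y → Adj G x y

deleteEdge : (G : SimpleGraph) → Edge G → SimpleGraph
Vertex    (deleteEdge G _) = Vertex G
Adj       (deleteEdge G (x , y , _)) a b =
  Adj G a b × ¬ ((a ≡ x × b ≡ y) ⊎ (a ≡ y × b ≡ x))
symmetric (deleteEdge G _) (a~b , ab≢e) =
  symmetric G a~b ,
  λ ba≡e → ab≢e ([ (λ (p , q) → inj₂ (q , p)) , (λ (p , q) → inj₁ (q , p)) ] ba≡e)
loopless  (deleteEdge G _) a (a~a , _) = loopless G a a~a

DeletionHost : SimpleGraph → SimpleGraph → Set₁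
DeletionHost G H =
  Edge G × ¬ ContainsInduced G H × (∀ (e : Edge G) → ContainsInduced (deleteEdge G e) H)

infixl 6 _△_

_△_ : ∀ {n} → Subset n → Subset n → Subset n
p △ q = (p ─ q) ∪ (q ─ p)

△-comm : ∀ {n} (p q : Subset n) → p △ q ≡ q △ p
△-comm p q = ∪-comm (p ─ q) (q ─ p)

p△p≡⊥ : ∀ {n} (p : Subset n) → p △ p ≡ Subset.⊥
p△p≡⊥ []            = refl
p△p≡⊥ (inside  ∷ p) = cong (outside ∷_) (p△p≡⊥ p)
p△p≡⊥ (outside ∷ p) = cong (outside ∷_) (p△p≡⊥ p)

-- Fin n plays the role of [n].
halvedCube : ℕ → SimpleGraph
Vertex    (halvedCube n)     = [ p ∈ Subset n ∣ (2 ∣ ∣ p ∣) ]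
Adj       (halvedCube n) x y = ∣ value x △ value y ∣ ≡ 2
symmetric (halvedCube n) {x} {y} =
  trans (cong ∣_∣ (△-comm (value y) (value x)))
loopless  (halvedCube n) x ∣x△x∣≡2
  with () ← trans (sym ∣x△x∣≡2) (trans (cong ∣_∣ (p△p≡⊥ (value x))) (∣⊥∣≡0 n))

clique : ℕ → SimpleGraph
Vertex    (clique m)       = Fin m
Adj       (clique m)       = _≢_
symmetric (clique m)       = ≢-sym
loopless  (clique m) _ i≢i = i≢i refl

-- The new vertex is nothing; its neighbourhood is S.
addVertex : (G : SimpleGraph) → Pred (Vertex G) 0ℓ → SimpleGraph
Vertex (addVertex G S) = Maybe (Vertex G)
Adj (addVertex G S) (just x) (just y) = Adj G x y
Adj (addVertex G S) (just x) nothing  = S x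
Adj (addVertex G S) nothing  (just y) = S y
Adj (addVertex G S) nothing  nothing  = ⊥
symmetric (addVertex G S) {just x}  {just y}  x~y = symmetric G x~y
symmetric (addVertex G S) {just x}  {nothing} x∈S = x∈S
symmetric (addVertex G S) {nothing} {just y}  y∈S = y∈S
loopless (addVertex G S) (just x) x~x = loopless G x x~x

-- By the symmetry of the clique, the choice of the two neighbours is immaterial
-- up to isomorphism; here they are 0 and 1, which are two vertices once m ≥ 2.
T : ℕ → SimpleGraph
T m = addVertex (clique m) (λ i → toℕ i < 2)

{-# OPTIONS --safe #-}

-- Write a clique of Δ_M and a further vertex v in coordinates centred at v,
-- X ↦ v △ X, so that adjacency to v means having size 2.
--
-- No induced T_M: the two neighbours A, B of v in the clique satisfy
-- |A ∩ B| = 1 and |A ∪ B| = 3.  Any other member C of the clique has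
-- |C △ A| = |C △ B| = 2 but |C| ∉ {0, 2}, which forces |C| = 4 and
-- A ∪ B ⊆ C.  Hence every member of the clique, A and B included, differs
-- from A ∪ B in a single element that is not the element of A ∩ B.  This
-- leaves only M - 1 possible members, too few for a clique of order M.
--
-- Deleting an edge xy with x △ y = {a, b}: pick c ∉ {a, b}.  The sets
-- x △ {a, b, c} △ {k} for k ∈ [M] form a clique avoiding x, whose members
-- adjacent to x are those with k ∈ {a, b, c}; the one with k = c is y.
module Submission where

open import Defs
open import Algebra.Definitions using (Associative; LeftIdentity)
open import Data.Bool.Base using (true; false; _xor_)
open import Data.Bool.Properties using (xor-assoc) renaming (_≟_ to _≟ᵇ_)
open import Data.Fin.Base using (Fin; zero; suc; toℕ; punchOut)
open import Data.Fin.Patterns using (0F; 1F; 2F)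
open import Data.Fin.Permutation using (Permutation′; _⟨$⟩ʳ_; insert; insert-punchIn)
  renaming (id to idₚ)
open import Data.Fin.Properties
  using (_≟_; any?; injective⇒≤; punchOut-injective; punchIn-punchOut; suc-injective)
open import Data.Fin.Subset as Subset
  using (Subset; inside; outside; _∈_; _∉_; _⊆_; _∩_; _∪_; ∣_∣; ⁅_⁆)
open import Data.Fin.Subset.Properties
  using (_∈?_; drop-∷-⊆; p∩q⊆p; p∩q⊆q; ∣p∩q∣≤∣p∣; p⊆p∪q; q⊆p∪q; x∈p∪q⁻;
         p⊂q⇒∣p∣<∣q∣; ∣⊥∣≡0; ∣⁅x⁆∣≡1; x∈⁅x⁆; x∈⁅y⁆⇒x≡y)
open import Data.Irrelevant using () renaming ([_] to [_]ⁱ)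
open import Data.Maybe.Base using (Maybe; just; nothing)
open import Data.Nat.Base using (ℕ; zero; suc; pred; _+_; _*_; _≤_; _<_; z≤n; s≤s)
open import Data.Nat.Divisibility using (_∣_; divides; ∣m∣n⇒∣m+n; ∣m+n∣m⇒∣n; m∣m*n)
open import Data.Nat.Properties
  using (+-suc; +-comm; +-cancelˡ-≡; +-cancelʳ-≡; *-cancelˡ-≡; <-irrefl; 1+n≰n)
open import Data.Nat.Tactic.RingSolver using (solve-∀)
open import Data.Product.Base using (∃; ∃₂; _×_; _,_; proj₁; proj₂)
open import Data.Refinement.Base using (value) renaming (_,_ to _,ʳ_)
open import Data.Refinement.Properties using (value-injective) renaming (_≟_ to _≟ʳ_)
open import Data.Sum.Base using (inj₁; inj₂)
open import Data.Vec.Base using ([]; _∷_; here; there; zipWith)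
open import Data.Vec.Properties using (zipWith-assoc; ≡-dec)
open import Function.Base using (_∘_)
open import Function.Bundles using (_⇔_; mk⇔; mk↔ₛ′; Equivalence; Inverse; Injection)
open import Function.Properties.Inverse using (↔⇒↣; ↔-sym)
open import Relation.Binary.Definitions using (DecidableEquality)
open import Relation.Binary.PropositionalEquality
  using (_≡_; _≢_; refl; sym; trans; cong; cong₂; subst; subst₂; module ≡-Reasoning)
open import Relation.Nullary.Decidable using (Dec; yes; no; recompute; decidable-stable)
open import Relation.Nullary.Negation using (¬_; contradiction)

private variable
  n : ℕ

-- Induced subgraphs as embeddings

-- The inverse isomorphism followed by `value` is the embedding. It is injective because membership
-- proofs are irrelevant, so a vertex of `G [ S ]` is determined by its `value`.
ContainsInduced⇒embedding : ∀ {G H} → ContainsInduced G H →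
  ∃ λ (f : Vertex H → Vertex G) → (∀ {x y} → f x ≡ f y → x ≡ y) ×
    (∀ x y → Adj H x y ⇔ Adj G (f x) (f y))
ContainsInduced⇒embedding {G} {H} (S , φ) = value ∘ from ,
  (λ eq → Injection.injective (↔⇒↣ (↔-sym vertices)) (value-injective eq)) ,
  λ x y → mk⇔ (λ x~y → Equivalence.from (adjacent (from x) (from y))
    (subst₂ (Adj H) (sym (to∘from x)) (sym (to∘from y)) x~y))
  (λ fx~fy → subst₂ (Adj H) (to∘from x) (to∘from y)
    (Equivalence.to (adjacent (from x) (from y)) fx~fy))
  where
  open _≅_ φ
  open Inverse vertices using (to; from)
  to∘from : ∀ x → to (from x) ≡ x
  to∘from = Inverse.strictlyInverseˡ vertices

embedding⇒ContainsInduced : ∀ {G H} (f : Vertex H → Vertex G) →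
  (∀ {x y} → f x ≡ f y → x ≡ y) → (∀ z → Dec (∃ λ x → f x ≡ z)) →
  (∀ x y → Adj H x y ⇔ Adj G (f x) (f y)) → ContainsInduced G H
embedding⇒ContainsInduced {G} {H} f f-injective image? f-adj = Image , record
  { vertices = mk↔ₛ′ to (λ x → f x ,ʳ [ x , refl ]ⁱ)
      (λ x → f-injective (f∘to (f x ,ʳ [ x , refl ]ⁱ)))
      (λ z → value-injective (f∘to z))
  ; adjacent = λ z w → mk⇔
      (λ z~w → Equivalence.from (f-adj _ _)
        (subst₂ (Adj G) (sym (f∘to z)) (sym (f∘to w)) z~w))
      (λ z~w → subst₂ (Adj G) (f∘to z) (f∘to w) (Equivalence.to (f-adj _ _) z~w))
  }
  where
  Image : Vertex G → Set
  Image z = ∃ λ x → f x ≡ z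
  -- Membership in the image is available only irrelevantly, so a preimage has
  -- to be found again by the decision procedure.
  preimage : (z : Vertex (G [ Image ])) → Image (value z)
  preimage (z ,ʳ [ z∈ ]ⁱ) = recompute (image? z) z∈
  to : Vertex (G [ Image ]) → Vertex H
  to z = proj₁ (preimage z)
  f∘to : ∀ z → f (to z) ≡ value z
  f∘to z = proj₂ (preimage z)

-- Distinct indices give adjacent, hence distinct, vertices because `G` is loopless. For a member
-- not adjacent to `v`, it is `f≢v` that rules out a collision. The image is decided by a finite
-- search.
clique+apex⇒T : ∀ {G m} → DecidableEquality (Vertex G) →
  (f : Fin m → Vertex G) (v : Vertex G) →
  (∀ {i j} → i ≢ j → Adj G (f i) (f j)) → (∀ i → f i ≢ v) →
  (∀ i → toℕ i < 2 ⇔ Adj G v (f i)) → ContainsInduced G (T m)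
clique+apex⇒T {G} {m} _≟ᵛ_ f v f-clique f≢v v-adj =
  embedding⇒ContainsInduced g g-injective image? g-adj
  where
  g : Maybe (Fin m) → Vertex G
  g (just i) = f i
  g nothing  = v

  adj⇒≢ : ∀ {x y} → Adj G x y → x ≢ y
  adj⇒≢ x~x refl = loopless G _ x~x

  g-injective : ∀ {x y} → g x ≡ g y → x ≡ y
  g-injective {just i}  {just j}  eq = cong just (decidable-stable (i ≟ j)
    (λ i≢j → adj⇒≢ (f-clique i≢j) eq))
  g-injective {just i}  {nothing} eq = contradiction eq (f≢v i)
  g-injective {nothing} {just j}  eq = contradiction (sym eq) (f≢v j)
  g-injective {nothing} {nothing} eq = refl

  image? : ∀ z → Dec (∃ λ x → g x ≡ z)
  image? z with v ≟ᵛ z | any? (λ i → f i ≟ᵛ z)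
  ... | yes v≡z | _               = yes (nothing , v≡z)
  ... | no _    | yes (i , fi≡z)  = yes (just i , fi≡z)
  ... | no v≢z  | no z∉f          =
    no λ { (just i , eq) → z∉f (i , eq) ; (nothing , eq) → v≢z eq }

  g-adj : ∀ x y → Adj (T m) x y ⇔ Adj G (g x) (g y)
  g-adj (just i) (just j) = mk⇔ f-clique (λ fi~fj i≡j → adj⇒≢ fi~fj (cong f i≡j))
  g-adj (just i) nothing  = mk⇔ (symmetric G ∘ Equivalence.to (v-adj i))
    (Equivalence.from (v-adj i) ∘ symmetric G)
  g-adj nothing  (just j) = v-adj j
  g-adj nothing  nothing  = mk⇔ (λ ()) (loopless G v)

-- Symmetric difference

-- Transfers associativity from `_xor_`, avoiding a case analysis on three subsets.
△≡zipWith-xor : (p q : Subset n) → p △ q ≡ zipWith _xor_ p q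
△≡zipWith-xor []          []          = refl
△≡zipWith-xor (true  ∷ p) (true  ∷ q) = cong (false ∷_) (△≡zipWith-xor p q)
△≡zipWith-xor (true  ∷ p) (false ∷ q) = cong (true  ∷_) (△≡zipWith-xor p q)
△≡zipWith-xor (false ∷ p) (true  ∷ q) = cong (true  ∷_) (△≡zipWith-xor p q)
△≡zipWith-xor (false ∷ p) (false ∷ q) = cong (false ∷_) (△≡zipWith-xor p q)

△-assoc : Associative _≡_ (_△_ {n})
△-assoc p q r = begin
  p △ q △ r                              ≡⟨ △≡zipWith-xor (p △ q) r ⟩
  zipWith _xor_ (p △ q) r                ≡⟨ cong (λ s → zipWith _xor_ s r) (△≡zipWith-xor p q) ⟩
  zipWith _xor_ (zipWith _xor_ p q) r    ≡⟨ zipWith-assoc xor-assoc p q r ⟩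
  zipWith _xor_ p (zipWith _xor_ q r)    ≡⟨ cong (zipWith _xor_ p) (△≡zipWith-xor q r) ⟨
  zipWith _xor_ p (q △ r)                ≡⟨ △≡zipWith-xor p (q △ r) ⟨
  p △ (q △ r)                            ∎
  where open ≡-Reasoning

△-identityˡ : LeftIdentity _≡_ Subset.⊥ (_△_ {n})
△-identityˡ []            = refl
△-identityˡ (inside  ∷ p) = cong (inside  ∷_) (△-identityˡ p)
△-identityˡ (outside ∷ p) = cong (outside ∷_) (△-identityˡ p)

p△[p△q]≡q : (p q : Subset n) → p △ (p △ q) ≡ q
p△[p△q]≡q p q = begin
  p △ (p △ q)    ≡⟨ △-assoc p p q ⟨
  p △ p △ q      ≡⟨ cong (_△ q) (p△p≡⊥ p) ⟩
  Subset.⊥ △ q   ≡⟨ △-identityˡ q ⟩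
  q              ∎
  where open ≡-Reasoning

[p△q]△q≡p : (p q : Subset n) → p △ q △ q ≡ p
[p△q]△q≡p p q = trans (△-comm (p △ q) q)
  (trans (cong (q △_) (△-comm p q)) (p△[p△q]≡q q p))

△-cancelˡ : (p q r : Subset n) → p △ q ≡ p △ r → q ≡ r
△-cancelˡ p q r eq =
  trans (sym (p△[p△q]≡q p q)) (trans (cong (p △_) eq) (p△[p△q]≡q p r))

△-cancelʳ : (p q r : Subset n) → q △ p ≡ r △ p → q ≡ r
△-cancelʳ p q r eq =
  △-cancelˡ p q r (trans (△-comm p q) (trans eq (△-comm r p)))

△-translateˡ : (p q r : Subset n) → (p △ q) △ (p △ r) ≡ q △ r
△-translateˡ p q r = begin
  (p △ q) △ (p △ r)   ≡⟨ cong (_△ (p △ r)) (△-comm p q) ⟩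
  (q △ p) △ (p △ r)   ≡⟨ △-assoc q p (p △ r) ⟩
  q △ (p △ (p △ r))   ≡⟨ cong (q △_) (p△[p△q]≡q p r) ⟩
  q △ r               ∎
  where open ≡-Reasoning

x∈p∧x∈q⇒x∉p△q : ∀ {x} {p q : Subset n} → x ∈ p → x ∈ q → x ∉ p △ q
x∈p∧x∈q⇒x∉p△q here        here        ()
x∈p∧x∈q⇒x∉p△q (there x∈p) (there x∈q) (there x∈) = x∈p∧x∈q⇒x∉p△q x∈p x∈q x∈

x∈p∧x∉q⇒x∈p△q : ∀ {x} {p q : Subset n} → x ∈ p → x ∉ q → x ∈ p △ q
x∈p∧x∉q⇒x∈p△q {q = inside  ∷ q} here        x∉q = contradiction here x∉q
x∈p∧x∉q⇒x∈p△q {q = outside ∷ q} here        x∉q = here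
x∈p∧x∉q⇒x∈p△q {q = _ ∷ q}       (there x∈p) x∉q = there (x∈p∧x∉q⇒x∈p△q x∈p (x∉q ∘ there))

x∉p∧x∈q⇒x∈p△q : ∀ {x} {p q : Subset n} → x ∉ p → x ∈ q → x ∈ p △ q
x∉p∧x∈q⇒x∈p△q {p = p} {q} x∉p x∈q =
  subst (_ ∈_) (△-comm q p) (x∈p∧x∉q⇒x∈p△q x∈q x∉p)

x∉p∧x∉q⇒x∉p△q : ∀ {x} {p q : Subset n} → x ∉ p → x ∉ q → x ∉ p △ q
x∉p∧x∉q⇒x∉p△q {x = x} {p} {q} x∉p x∉q x∈ =
  -- If `x` lay in `p △ q` but not in `p`, it would lie in `p △ (p △ q)`, which is `q`.
  x∉q (subst (x ∈_) (p△[p△q]≡q p q) (x∉p∧x∈q⇒x∈p△q x∉p x∈))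

-- Cardinalities

-- The additive form avoids truncated subtraction. It yields both the parity of `p △ q` and the size
-- restriction on clique members.
∣p△q∣+2∣p∩q∣≡∣p∣+∣q∣ : (p q : Subset n) → ∣ p △ q ∣ + 2 * ∣ p ∩ q ∣ ≡ ∣ p ∣ + ∣ q ∣
∣p△q∣+2∣p∩q∣≡∣p∣+∣q∣ []          []          = refl
∣p△q∣+2∣p∩q∣≡∣p∣+∣q∣ (true  ∷ p) (true  ∷ q) = begin
  ∣ p △ q ∣ + 2 * suc ∣ p ∩ q ∣       ≡⟨ shift ∣ p △ q ∣ ∣ p ∩ q ∣ ⟩
  2 + (∣ p △ q ∣ + 2 * ∣ p ∩ q ∣)     ≡⟨ cong (2 +_) (∣p△q∣+2∣p∩q∣≡∣p∣+∣q∣ p q) ⟩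
  2 + (∣ p ∣ + ∣ q ∣)                 ≡⟨ cong suc (+-suc ∣ p ∣ ∣ q ∣) ⟨
  suc ∣ p ∣ + suc ∣ q ∣               ∎
  where
  open ≡-Reasoning
  shift : ∀ a b → a + 2 * suc b ≡ 2 + (a + 2 * b)
  shift = solve-∀
∣p△q∣+2∣p∩q∣≡∣p∣+∣q∣ (true  ∷ p) (false ∷ q) = cong suc (∣p△q∣+2∣p∩q∣≡∣p∣+∣q∣ p q)
∣p△q∣+2∣p∩q∣≡∣p∣+∣q∣ (false ∷ p) (true  ∷ q) =
  trans (cong suc (∣p△q∣+2∣p∩q∣≡∣p∣+∣q∣ p q)) (sym (+-suc ∣ p ∣ ∣ q ∣))
∣p△q∣+2∣p∩q∣≡∣p∣+∣q∣ (false ∷ p) (false ∷ q) = ∣p△q∣+2∣p∩q∣≡∣p∣+∣q∣ p q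

∣p∪q∣+∣p∩q∣≡∣p∣+∣q∣ : (p q : Subset n) → ∣ p ∪ q ∣ + ∣ p ∩ q ∣ ≡ ∣ p ∣ + ∣ q ∣
∣p∪q∣+∣p∩q∣≡∣p∣+∣q∣ []          []          = refl
∣p∪q∣+∣p∩q∣≡∣p∣+∣q∣ (true  ∷ p) (true  ∷ q) = cong suc (trans (+-suc ∣ p ∪ q ∣ ∣ p ∩ q ∣)
  (trans (cong suc (∣p∪q∣+∣p∩q∣≡∣p∣+∣q∣ p q)) (sym (+-suc ∣ p ∣ ∣ q ∣))))
∣p∪q∣+∣p∩q∣≡∣p∣+∣q∣ (true  ∷ p) (false ∷ q) = cong suc (∣p∪q∣+∣p∩q∣≡∣p∣+∣q∣ p q)
∣p∪q∣+∣p∩q∣≡∣p∣+∣q∣ (false ∷ p) (true  ∷ q) =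
  trans (cong suc (∣p∪q∣+∣p∩q∣≡∣p∣+∣q∣ p q)) (sym (+-suc ∣ p ∣ ∣ q ∣))
∣p∪q∣+∣p∩q∣≡∣p∣+∣q∣ (false ∷ p) (false ∷ q) = ∣p∪q∣+∣p∩q∣≡∣p∣+∣q∣ p q

△-even : (p q : Subset n) → 2 ∣ ∣ p ∣ → 2 ∣ ∣ q ∣ → 2 ∣ ∣ p △ q ∣
△-even p q 2∣p 2∣q = ∣m+n∣m⇒∣n
  (subst (2 ∣_) (trans (sym (∣p△q∣+2∣p∩q∣≡∣p∣+∣q∣ p q)) (+-comm ∣ p △ q ∣ _))
    (∣m∣n⇒∣m+n 2∣p 2∣q))
  (m∣m*n ∣ p ∩ q ∣)

p⊆q⇒∣p△q∣+∣p∣≡∣q∣ : {p q : Subset n} → p ⊆ q → ∣ p △ q ∣ + ∣ p ∣ ≡ ∣ q ∣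
p⊆q⇒∣p△q∣+∣p∣≡∣q∣ {p = []}          {[]}          p⊆q = refl
p⊆q⇒∣p△q∣+∣p∣≡∣q∣ {p = true  ∷ p} {true  ∷ q} p⊆q =
  trans (+-suc ∣ p △ q ∣ ∣ p ∣) (cong suc (p⊆q⇒∣p△q∣+∣p∣≡∣q∣ (drop-∷-⊆ p⊆q)))
p⊆q⇒∣p△q∣+∣p∣≡∣q∣ {p = true  ∷ p} {false ∷ q} p⊆q with () ← p⊆q here
p⊆q⇒∣p△q∣+∣p∣≡∣q∣ {p = false ∷ p} {true  ∷ q} p⊆q = cong suc (p⊆q⇒∣p△q∣+∣p∣≡∣q∣ (drop-∷-⊆ p⊆q))
p⊆q⇒∣p△q∣+∣p∣≡∣q∣ {p = false ∷ p} {false ∷ q} p⊆q = p⊆q⇒∣p△q∣+∣p∣≡∣q∣ (drop-∷-⊆ p⊆q)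

∣p∩q∣≡∣p∣⇒p⊆q : (p q : Subset n) → ∣ p ∩ q ∣ ≡ ∣ p ∣ → p ⊆ q
∣p∩q∣≡∣p∣⇒p⊆q p q eq {x} x∈p = decidable-stable (x ∈? q) λ x∉q →
  <-irrefl eq (p⊂q⇒∣p∣<∣q∣ (p∩q⊆p p q , x , x∈p , x∉q ∘ p∩q⊆q p q))

x∉p⇒∣p△⁅x⁆∣≡1+∣p∣ : ∀ {x} {p : Subset n} → x ∉ p → ∣ p △ ⁅ x ⁆ ∣ ≡ suc ∣ p ∣
x∉p⇒∣p△⁅x⁆∣≡1+∣p∣ {x = zero}  {inside  ∷ p} x∉p = contradiction here x∉p
x∉p⇒∣p△⁅x⁆∣≡1+∣p∣ {x = zero}  {outside ∷ p} x∉p =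
  cong (suc ∘ ∣_∣) (trans (△-comm p Subset.⊥) (△-identityˡ p))
x∉p⇒∣p△⁅x⁆∣≡1+∣p∣ {x = suc x} {inside  ∷ p} x∉p = cong suc (x∉p⇒∣p△⁅x⁆∣≡1+∣p∣ (x∉p ∘ there))
x∉p⇒∣p△⁅x⁆∣≡1+∣p∣ {x = suc x} {outside ∷ p} x∉p = x∉p⇒∣p△⁅x⁆∣≡1+∣p∣ (x∉p ∘ there)

-- The previous lemma applied to `p △ ⁅ x ⁆`, which omits `x` and returns to `p` when `x` is toggled
-- again.
x∈p⇒1+∣p△⁅x⁆∣≡∣p∣ : ∀ {x} {p : Subset n} → x ∈ p → suc ∣ p △ ⁅ x ⁆ ∣ ≡ ∣ p ∣
x∈p⇒1+∣p△⁅x⁆∣≡∣p∣ {x = x} {p} x∈p = trans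
  (sym (x∉p⇒∣p△⁅x⁆∣≡1+∣p∣ (x∈p∧x∈q⇒x∉p△q x∈p (x∈⁅x⁆ x))))
  (cong ∣_∣ ([p△q]△q≡p p ⁅ x ⁆))

∣p∣≡0⇒p≡⊥ : (p : Subset n) → ∣ p ∣ ≡ 0 → p ≡ Subset.⊥
∣p∣≡0⇒p≡⊥ []            _  = refl
∣p∣≡0⇒p≡⊥ (outside ∷ p) eq = cong (outside ∷_) (∣p∣≡0⇒p≡⊥ p eq)

∣p∣≡1⇒p≡⁅x⁆ : (p : Subset n) → ∣ p ∣ ≡ 1 → ∃ λ x → p ≡ ⁅ x ⁆
∣p∣≡1⇒p≡⁅x⁆ (inside  ∷ p) eq = zero , cong (inside ∷_) (∣p∣≡0⇒p≡⊥ p (cong pred eq))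
∣p∣≡1⇒p≡⁅x⁆ (outside ∷ p) eq with x , refl ← ∣p∣≡1⇒p≡⁅x⁆ p eq = suc x , refl

∣p∣≡2⇒p≡⁅x⁆△⁅y⁆ : (p : Subset n) → ∣ p ∣ ≡ 2 → ∃₂ λ x y → x ≢ y × p ≡ ⁅ x ⁆ △ ⁅ y ⁆
∣p∣≡2⇒p≡⁅x⁆△⁅y⁆ (inside  ∷ p) eq with y , refl ← ∣p∣≡1⇒p≡⁅x⁆ p (cong pred eq) =
  zero , suc y , (λ ()) , cong (inside ∷_) (sym (△-identityˡ ⁅ y ⁆))
∣p∣≡2⇒p≡⁅x⁆△⁅y⁆ (outside ∷ p) eq with x , y , x≢y , refl ← ∣p∣≡2⇒p≡⁅x⁆△⁅y⁆ p eq =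
  suc x , suc y , x≢y ∘ suc-injective , refl

x≢y⇒∣⁅x⁆△⁅y⁆∣≡2 : {x y : Fin n} → x ≢ y → ∣ ⁅ x ⁆ △ ⁅ y ⁆ ∣ ≡ 2
x≢y⇒∣⁅x⁆△⁅y⁆∣≡2 {x = x} x≢y = trans
  (x∉p⇒∣p△⁅x⁆∣≡1+∣p∣ (x≢y ∘ sym ∘ x∈⁅y⁆⇒x≡y x)) (cong suc (∣⁅x⁆∣≡1 x))

-- Absence of T

∣p∣≡∣p△q∣≡2⇒∣q∣≡2∣p∩q∣ : (p q : Subset n) → ∣ p ∣ ≡ 2 → ∣ p △ q ∣ ≡ 2 → ∣ q ∣ ≡ 2 * ∣ p ∩ q ∣
∣p∣≡∣p△q∣≡2⇒∣q∣≡2∣p∩q∣ p q ∣p∣≡2 ∣p△q∣≡2 = +-cancelˡ-≡ 2 _ _ (begin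
  2 + ∣ q ∣                      ≡⟨ cong (_+ ∣ q ∣) ∣p∣≡2 ⟨
  ∣ p ∣ + ∣ q ∣                  ≡⟨ ∣p△q∣+2∣p∩q∣≡∣p∣+∣q∣ p q ⟨
  ∣ p △ q ∣ + 2 * ∣ p ∩ q ∣      ≡⟨ cong (_+ 2 * ∣ p ∩ q ∣) ∣p△q∣≡2 ⟩
  2 + 2 * ∣ p ∩ q ∣              ∎)
  where open ≡-Reasoning

-- Here `∣ q ∣` is twice `∣ p ∩ q ∣`, and the intersection has at most two elements. Excluding sizes
-- 0 and 2 leaves an intersection as large as `p`.
∣p∣≡∣p△q∣≡2⇒p⊆q : (p q : Subset n) → ∣ p ∣ ≡ 2 → ∣ p △ q ∣ ≡ 2 →
  ∣ q ∣ ≢ 0 → ∣ q ∣ ≢ 2 → p ⊆ q × ∣ q ∣ ≡ 4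
∣p∣≡∣p△q∣≡2⇒p⊆q p q ∣p∣≡2 ∣p△q∣≡2 ∣q∣≢0 ∣q∣≢2
  with ∣ p ∩ q ∣ in ∣p∩q∣≡ | ∣p∣≡∣p△q∣≡2⇒∣q∣≡2∣p∩q∣ p q ∣p∣≡2 ∣p△q∣≡2 | ∣p∩q∣≤∣p∣ p q
... | 0 | ∣q∣≡ | _ = contradiction ∣q∣≡ ∣q∣≢0
... | 1 | ∣q∣≡ | _ = contradiction ∣q∣≡ ∣q∣≢2
... | 2 | ∣q∣≡ | _ = ∣p∩q∣≡∣p∣⇒p⊆q p q (trans ∣p∩q∣≡ (sym ∣p∣≡2)) , ∣q∣≡
... | suc (suc (suc k)) | _ | k+3≤∣p∣ with s≤s (s≤s ()) ← subst (3 + k ≤_) ∣p∣≡2 k+3≤∣p∣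

halvedCube-T-free : ∀ m → ¬ ContainsInduced (halvedCube (2 + m)) (T (2 + m))
-- Pigeonhole: `punchOut` would inject `Fin (2 + m)` into `Fin (1 + m)`.
halvedCube-T-free m T⊑Δ = 1+n≰n (injective⇒≤ punched-injective)
  where
  M = 2 + m

  f : Vertex (T M) → Vertex (halvedCube M)
  f = proj₁ (ContainsInduced⇒embedding T⊑Δ)

  f-adj : ∀ x y → Adj (T M) x y ⇔ Adj (halvedCube M) (f x) (f y)
  f-adj = proj₂ (proj₂ (ContainsInduced⇒embedding T⊑Δ))

  f-injective : ∀ {x y} → f x ≡ f y → x ≡ y
  f-injective = proj₁ (proj₂ (ContainsInduced⇒embedding T⊑Δ))

  v : Subset M
  v = value (f nothing)

  X : Fin M → Subset M
  X i = v △ value (f (just i))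

  X-clique : ∀ {i j} → i ≢ j → ∣ X i △ X j ∣ ≡ 2
  X-clique {i} {j} i≢j = trans (cong ∣_∣ (△-translateˡ v _ _))
    (Equivalence.to (f-adj (just i) (just j)) i≢j)

  X-injective : ∀ {i j} → X i ≡ X j → i ≡ j
  X-injective eq with refl ← f-injective (value-injective (△-cancelˡ v _ _ eq)) = refl

  A B U I : Subset M
  A = X 0F
  B = X 1F
  U = A ∪ B
  I = A ∩ B

  ∣A∣≡2 : ∣ A ∣ ≡ 2
  ∣A∣≡2 = Equivalence.to (f-adj nothing (just 0F)) (s≤s z≤n)

  ∣B∣≡2 : ∣ B ∣ ≡ 2
  ∣B∣≡2 = Equivalence.to (f-adj nothing (just 1F)) (s≤s (s≤s z≤n))

  ∣I∣≡1 : ∣ I ∣ ≡ 1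
  ∣I∣≡1 = *-cancelˡ-≡ _ 1 2 (trans
    (sym (∣p∣≡∣p△q∣≡2⇒∣q∣≡2∣p∩q∣ A B ∣A∣≡2 (X-clique λ ()))) ∣B∣≡2)

  ∣U∣≡3 : ∣ U ∣ ≡ 3
  ∣U∣≡3 = +-cancelʳ-≡ 1 _ 3 (begin
    ∣ U ∣ + 1       ≡⟨ cong (∣ U ∣ +_) ∣I∣≡1 ⟨
    ∣ U ∣ + ∣ I ∣   ≡⟨ ∣p∪q∣+∣p∩q∣≡∣p∣+∣q∣ A B ⟩
    ∣ A ∣ + ∣ B ∣   ≡⟨ cong₂ _+_ ∣A∣≡2 ∣B∣≡2 ⟩
    4               ∎)
    where open ≡-Reasoning

  -- The single common element of `A` and `B`; it is the value that `k` never takes.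
  t : Fin M
  t = proj₁ (∣p∣≡1⇒p≡⁅x⁆ I ∣I∣≡1)

  t∈I : t ∈ I
  t∈I = subst (t ∈_) (sym (proj₂ (∣p∣≡1⇒p≡⁅x⁆ I ∣I∣≡1))) (x∈⁅x⁆ t)

  t∈A : t ∈ A
  t∈A = p∩q⊆p A B t∈I

  ∣△∣-⊆ : ∀ (p q : Subset M) a b → p ⊆ q → ∣ p ∣ ≡ b → ∣ q ∣ ≡ a + b → ∣ p △ q ∣ ≡ a
  ∣△∣-⊆ p q a b p⊆q ∣p∣≡b ∣q∣≡a+b = +-cancelʳ-≡ b _ a (trans
    (trans (cong (_ +_) (sym ∣p∣≡b)) (p⊆q⇒∣p△q∣+∣p∣≡∣q∣ p⊆q)) ∣q∣≡a+b)

  -- `A` and `B` lie one element below `U`, every other member one element above it. All contain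
  -- `t`, so the differing element is never `t`.
  X-near-U : ∀ i → ∣ X i △ U ∣ ≡ 1 × t ∈ X i
  X-near-U 0F = ∣△∣-⊆ A U 1 2 (p⊆p∪q B) ∣A∣≡2 ∣U∣≡3 , t∈A
  X-near-U 1F = ∣△∣-⊆ B U 1 2 (q⊆p∪q A B) ∣B∣≡2 ∣U∣≡3 , p∩q⊆q A B t∈I
  X-near-U (suc (suc i)) =
    trans (cong ∣_∣ (△-comm C U)) (∣△∣-⊆ U C 1 3 U⊆C ∣U∣≡3 (proj₂ A⊆C)) , proj₁ A⊆C t∈A
    where
    C : Subset M
    C = X (suc (suc i))

    ∣C∣≢2 : ∣ C ∣ ≢ 2
    ∣C∣≢2 ∣C∣≡2 with s≤s (s≤s ()) ← Equivalence.from (f-adj nothing (just (suc (suc i)))) ∣C∣≡2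

    ∣C∣≢0 : ∣ C ∣ ≢ 0
    ∣C∣≢0 ∣C∣≡0
      -- An empty `C` equals `v △ v`, so this clique vertex would coincide with the apex.
      with () ← f-injective (value-injective (△-cancelˡ v _ _
        (trans (p△p≡⊥ v) (sym (∣p∣≡0⇒p≡⊥ C ∣C∣≡0)))))

    A⊆C : A ⊆ C × ∣ C ∣ ≡ 4
    A⊆C = ∣p∣≡∣p△q∣≡2⇒p⊆q A C ∣A∣≡2 (X-clique λ ()) ∣C∣≢0 ∣C∣≢2

    B⊆C : B ⊆ C × ∣ C ∣ ≡ 4
    B⊆C = ∣p∣≡∣p△q∣≡2⇒p⊆q B C ∣B∣≡2 (X-clique λ ()) ∣C∣≢0 ∣C∣≢2

    U⊆C : U ⊆ C
    U⊆C x∈U with x∈p∪q⁻ A B x∈U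
    ... | inj₁ x∈A = proj₁ A⊆C x∈A
    ... | inj₂ x∈B = proj₁ B⊆C x∈B

  k : Fin M → Fin M
  k i = proj₁ (∣p∣≡1⇒p≡⁅x⁆ (X i △ U) (proj₁ (X-near-U i)))

  X△U≡⁅k⁆ : ∀ i → X i △ U ≡ ⁅ k i ⁆
  X△U≡⁅k⁆ i = proj₂ (∣p∣≡1⇒p≡⁅x⁆ (X i △ U) (proj₁ (X-near-U i)))

  t≢k : ∀ i → t ≢ k i
  t≢k i t≡k = x∈p∧x∈q⇒x∉p△q (proj₂ (X-near-U i)) (p⊆p∪q B t∈A)
    (subst (t ∈_) (sym (X△U≡⁅k⁆ i)) (subst (λ x → t ∈ ⁅ x ⁆) t≡k (x∈⁅x⁆ t)))

  -- `k i` determines `X i △ U`, and cancelling `U` recovers `X i`.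
  punched-injective : ∀ {i j} → punchOut (t≢k i) ≡ punchOut (t≢k j) → i ≡ j
  punched-injective {i} {j} eq = X-injective (△-cancelʳ U _ _ (trans (X△U≡⁅k⁆ i)
    (trans (cong ⁅_⁆ (punchOut-injective (t≢k i) (t≢k j) eq)) (sym (X△U≡⁅k⁆ j)))))

-- Presence of T after deleting an edge

-- `insert 0F p σ` sends 0 to `p` and otherwise follows `σ` through `punchIn p`. So `σ` must send 0
-- to the index that `punchIn p` carries to `q`.
extendPair : {p q : Fin (2 + n)} → p ≢ q →
  ∃ λ (π : Permutation′ (2 + n)) → π ⟨$⟩ʳ 0F ≡ p × π ⟨$⟩ʳ 1F ≡ q
extendPair {p = p} p≢q = insert 0F p σ , refl ,
  trans (insert-punchIn 0F p σ 0F) (punchIn-punchOut p≢q)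
  where σ = insert 0F (punchOut p≢q) idₚ

deleteEdge-T : ∀ m (e : Edge (halvedCube (3 + m))) →
  ContainsInduced (deleteEdge (halvedCube (3 + m)) e) (T (3 + m))
deleteEdge-T m e@(x@(p ,ʳ [ p-even ]ⁱ) , y , x~y)
  with a , b , a≢b , p△y≡ab ← ∣p∣≡2⇒p≡⁅x⁆△⁅y⁆ (p △ value y) x~y
  -- Relabels the ground set so that `a` and `b` become the images of 0 and 1. The image of 2 then
  -- serves as the third element `c` of the overview.
  with π , refl , refl ← extendPair a≢b =
  clique+apex⇒T (_≟ʳ_ (≡-dec _≟ᵇ_)) K x K-clique K≢x K-adj
  where
  M = 3 + m

  c : Fin M → Subset M
  c i = ⁅ π ⟨$⟩ʳ i ⁆

  π-injective : ∀ {i j} → π ⟨$⟩ʳ i ≡ π ⟨$⟩ʳ j → i ≡ j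
  π-injective = Injection.injective (↔⇒↣ π)

  π∉c : ∀ {i j} → i ≢ j → π ⟨$⟩ʳ i ∉ c j
  π∉c {j = j} i≢j = i≢j ∘ π-injective ∘ x∈⁅y⁆⇒x≡y (π ⟨$⟩ʳ j)

  π∈c : ∀ i → π ⟨$⟩ʳ i ∈ c i
  π∈c i = x∈⁅x⁆ (π ⟨$⟩ʳ i)

  U : Subset M
  U = c 0F △ c 1F △ c 2F

  ∣U∣≡3 : ∣ U ∣ ≡ 3
  ∣U∣≡3 = trans
    (x∉p⇒∣p△⁅x⁆∣≡1+∣p∣ (x∉p∧x∉q⇒x∉p△q (π∉c λ ()) (π∉c λ ())))
    (cong suc (x≢y⇒∣⁅x⁆△⁅y⁆∣≡2 a≢b))

  -- The clique in coordinates centred at `x`; `K` translates it back by `p`.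
  D : Fin M → Subset M
  D i = U △ c i

  ∈U⇒∣D∣≡2 : ∀ i → π ⟨$⟩ʳ i ∈ U → ∣ D i ∣ ≡ 2
  ∈U⇒∣D∣≡2 i πi∈U = cong pred (trans (x∈p⇒1+∣p△⁅x⁆∣≡∣p∣ πi∈U) ∣U∣≡3)

  ∣D₀∣≡2 : ∣ D 0F ∣ ≡ 2
  ∣D₀∣≡2 = ∈U⇒∣D∣≡2 0F
    (x∈p∧x∉q⇒x∈p△q (x∈p∧x∉q⇒x∈p△q (π∈c 0F) (π∉c λ ())) (π∉c λ ()))

  ∣D₁∣≡2 : ∣ D 1F ∣ ≡ 2
  ∣D₁∣≡2 = ∈U⇒∣D∣≡2 1F
    (x∈p∧x∉q⇒x∈p△q (x∉p∧x∈q⇒x∈p△q (π∉c λ ()) (π∈c 1F)) (π∉c λ ()))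

  ∣D₂∣≡2 : ∣ D 2F ∣ ≡ 2
  ∣D₂∣≡2 = ∈U⇒∣D∣≡2 2F
    (x∉p∧x∈q⇒x∈p△q (x∉p∧x∉q⇒x∉p△q (π∉c λ ()) (π∉c λ ())) (π∈c 2F))

  ∣D₃₊∣≡4 : ∀ i → ∣ D (suc (suc (suc i))) ∣ ≡ 4
  ∣D₃₊∣≡4 i = trans (x∉p⇒∣p△⁅x⁆∣≡1+∣p∣
    (x∉p∧x∉q⇒x∉p△q (x∉p∧x∉q⇒x∉p△q (π∉c λ ()) (π∉c λ ())) (π∉c λ ()))) (cong suc ∣U∣≡3)

  D-even : ∀ i → 2 ∣ ∣ D i ∣
  D-even 0F = divides 1 ∣D₀∣≡2
  D-even 1F = divides 1 ∣D₁∣≡2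
  D-even 2F = divides 1 ∣D₂∣≡2
  D-even (suc (suc (suc i))) = divides 2 (∣D₃₊∣≡4 i)

  K : Fin M → Vertex (halvedCube M)
  K i = p △ D i ,ʳ [ △-even p (D i) p-even (D-even i) ]ⁱ

  ∣p△K∣≡∣D∣ : ∀ i → ∣ p △ value (K i) ∣ ≡ ∣ D i ∣
  ∣p△K∣≡∣D∣ i = cong ∣_∣ (p△[p△q]≡q p (D i))

  -- Toggling the third element out of `U` leaves `c 0F △ c 1F`, which is `p △ value y`.
  K₂≡y : K 2F ≡ y
  K₂≡y = value-injective (△-cancelˡ p _ _ (trans (p△[p△q]≡q p (D 2F))
    (trans ([p△q]△q≡p (c 0F △ c 1F) (c 2F)) (sym p△y≡ab))))

  K-adjacent : ∀ {i j} → i ≢ j → Adj (halvedCube M) (K i) (K j)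
  K-adjacent {i} {j} i≢j = trans
    (cong ∣_∣ (trans (△-translateˡ p (D i) (D j)) (△-translateˡ U (c i) (c j))))
    (x≢y⇒∣⁅x⁆△⁅y⁆∣≡2 (i≢j ∘ π-injective))

  ∣D∣≢0 : ∀ i → ∣ D i ∣ ≢ 0
  ∣D∣≢0 0F eq with () ← trans (sym eq) ∣D₀∣≡2
  ∣D∣≢0 1F eq with () ← trans (sym eq) ∣D₁∣≡2
  ∣D∣≢0 2F eq with () ← trans (sym eq) ∣D₂∣≡2
  ∣D∣≢0 (suc (suc (suc i))) eq with () ← trans (sym eq) (∣D₃₊∣≡4 i)

  K≢x : ∀ i → K i ≢ x
  K≢x i Ki≡x = ∣D∣≢0 i (trans (sym (∣p△K∣≡∣D∣ i)) (trans
    (cong (λ z → ∣ p △ value z ∣) Ki≡x) (trans (cong ∣_∣ (p△p≡⊥ p)) (∣⊥∣≡0 M))))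

  -- The deleted edge has `x` as an end and no member is `x`, so no clique edge is lost.
  K-clique : ∀ {i j} → i ≢ j → Adj (deleteEdge (halvedCube M) e) (K i) (K j)
  K-clique {i} {j} i≢j = K-adjacent i≢j , λ
    { (inj₁ (Ki≡x , _)) → K≢x i Ki≡x
    ; (inj₂ (_ , Kj≡x)) → K≢x j Kj≡x }

  K≢y : ∀ {i} → i ≢ 2F → K i ≢ y
  -- `K i` is adjacent to `K 2F`, which is `y`; equality with `y` would be a loop.
  K≢y {i} i≢2 Ki≡y = loopless (halvedCube M) (K i)
    (subst (Adj (halvedCube M) (K i)) (trans K₂≡y (sym Ki≡y)) (K-adjacent i≢2))

  x-adj : ∀ {i} → i ≢ 2F → ∣ D i ∣ ≡ 2 → Adj (deleteEdge (halvedCube M) e) x (K i)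
  x-adj {i} i≢2 ∣Di∣≡2 = trans (∣p△K∣≡∣D∣ i) ∣Di∣≡2 , λ
    { (inj₁ (_ , Ki≡y)) → K≢y i≢2 Ki≡y
    ; (inj₂ (_ , Ki≡x)) → K≢x i Ki≡x }

  K-adj : ∀ i → toℕ i < 2 ⇔ Adj (deleteEdge (halvedCube M) e) x (K i)
  K-adj 0F = mk⇔ (λ _ → x-adj (λ ()) ∣D₀∣≡2) (λ _ → s≤s z≤n)
  K-adj 1F = mk⇔ (λ _ → x-adj (λ ()) ∣D₁∣≡2) (λ _ → s≤s (s≤s z≤n))
  -- At distance 2 from `x` in the halved cube, but this is exactly the deleted edge.
  K-adj 2F = mk⇔ (λ { (s≤s (s≤s ())) })
    (λ (_ , xK₂≢e) → contradiction (inj₁ (refl , K₂≡y)) xK₂≢e)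
  K-adj i@(suc (suc (suc j))) = mk⇔ (λ { (s≤s (s≤s ())) }) λ (x~Ki , _) →
    contradiction (trans (sym (∣D₃₊∣≡4 j)) (trans (sym (∣p△K∣≡∣D∣ i)) x~Ki)) λ ()

halvedCube-edge : ∀ m → Edge (halvedCube (2 + m))
halvedCube-edge m =
  (Subset.⊥ ,ʳ [ divides 0 (∣⊥∣≡0 (2 + m)) ]ⁱ) , (ab ,ʳ [ divides 1 ∣ab∣≡2 ]ⁱ) ,
  trans (cong ∣_∣ (△-identityˡ ab)) ∣ab∣≡2
  where
  ab : Subset (2 + m)
  ab = ⁅ 0F ⁆ △ ⁅ 1F ⁆
  ∣ab∣≡2 : ∣ ab ∣ ≡ 2
  ∣ab∣≡2 = x≢y⇒∣⁅x⁆△⁅y⁆∣≡2 {n = 2 + m} {0F} {1F} λ ()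

proposition6p1 : (M : ℕ) → 4 ≤ M → DeletionHost (halvedCube M) (T M)
proposition6p1 (suc (suc (suc (suc m)))) (s≤s (s≤s (s≤s (s≤s _)))) =
  -- `4 + m` is read as `2 + (2 + m)` for the first two components and as `3 + (1 + m)` for the
  -- third.
  halvedCube-edge (2 + m) , halvedCube-T-free (2 + m) , deleteEdge-T (1 + m)
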